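{- Let $\mathbf{A} \in \mathsf{CIdInRL}$. Then the collection $\{ B_x \mid x \in A \}$ is a partition of $A$.
   Context: A commutative idempotent involutive residuated lattice is an algebra $\mathbf{A}=\langle A,\wedge,\vee,\cdot,\to,1,0\rangle$ such that $\langle A,\wedge,\vee\rangle$ is a lattice (with lattice order $\leq$), $\langle A,\cdot,1\rangle$ is a commutative monoid with $x\cdot x=x$ for all $x$, residuation holds ($x\cdot y\leq z \iff y\leq x\to z$), and, writing $-x := x\to 0$, one has $-{ - }x=x$ for all $x$. The class of these algebras is $\mathsf{CIdInRL}$. The monoidal order is $x\sqsubseteq y :\Leftrightarrow x\cdot y=x$. For $x\in A$ put $1_x := x\vee -x$, $0_x := x\wedge -x$, and $B_x := \{y\in A \mid 0_x\sqsubseteq y\sqsubseteq 1_x\}$. -}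

module Defs where

open import Level using (Level; _⊔_; suc)
open import Algebra.Core using (Op₁; Op₂)
open import Algebra.Definitions using (Congruent₂; Involutive)
open import Algebra.Structures using (IsIdempotentCommutativeMonoid)
open import Algebra.Lattice.Structures using (IsLattice)
open import Data.Product using (_×_; ∃-syntax)
open import Function.Bundles using (_⇔_)
open import Relation.Binary.Core using (Rel)
open import Relation.Binary.Bundles using (Setoid)
open import Relation.Binary.Definitions using (_Respects_)
open import Relation.Unary using (Pred; _∈_; _≐_; _≬_; Satisfiable)

-- Commutative idempotent involutive residuated lattices, over a setoid.
-- `_⇒_` is the residual of `_·_`; `⇒-cong` follows from `residuated` and is
-- listed only because operations on a setoid are required to be congruent.
record CIdInRL (c ℓ : Level) : Set (suc (c ⊔ ℓ)) where
  infix  4 _≈_ _≤_ _⊑_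
  infixr 5 _⇒_
  infixr 6 _∨_
  infixr 7 _∧_
  infixl 8 _·_
  infix  9 -_
  field
    Carrier : Set c
    _≈_     : Rel Carrier ℓ
    _∧_     : Op₂ Carrier
    _∨_     : Op₂ Carrier
    _·_     : Op₂ Carrier
    _⇒_     : Op₂ Carrier
    1#      : Carrier
    0#      : Carrier

  _≤_ : Rel Carrier ℓ
  x ≤ y = x ∧ y ≈ x

  -_ : Op₁ Carrier
  - x = x ⇒ 0#

  field
    isLattice  : IsLattice _≈_ _∨_ _∧_
    ·-isIdempotentCommutativeMonoid : IsIdempotentCommutativeMonoid _≈_ _·_ 1#
    ⇒-cong     : Congruent₂ _≈_ _⇒_
    residuated : ∀ x y z → x · y ≤ z ⇔ y ≤ x ⇒ z
    involutive : Involutive _≈_ -_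

  setoid : Setoid c ℓ
  setoid = record { isEquivalence = IsLattice.isEquivalence isLattice }

  _⊑_ : Rel Carrier ℓ
  x ⊑ y = x · y ≈ x

  1[_] : Op₁ Carrier
  1[ x ] = x ∨ - x

  0[_] : Op₁ Carrier
  0[ x ] = x ∧ - x

  B : Carrier → Pred Carrier ℓ
  B x y = 0[ x ] ⊑ y × y ⊑ 1[ x ]

  -- The collection { B x ∣ x ∈ Carrier }, with extensional equality of subsets.
  Blocks : Pred (Pred Carrier ℓ) (c ⊔ ℓ)
  Blocks S = ∃[ x ] S ≐ B x

-- A collection of subsets of a setoid partitioning it.  `disjoint` is the
-- positive form of pairwise disjointness: members that meet are equal, so
-- distinct members do not meet.
record IsPartition {a ℓ s p : Level} (A : Setoid a ℓ)
                   (𝓟 : Pred (Pred (Setoid.Carrier A) s) p) : Set (a ⊔ ℓ ⊔ suc s ⊔ p) where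
  open Setoid A using (Carrier; _≈_)
  field
    respects : ∀ {S} → S ∈ 𝓟 → S Respects _≈_
    nonempty : ∀ {S} → S ∈ 𝓟 → Satisfiable S
    covers   : ∀ x → ∃[ S ] S ∈ 𝓟 × x ∈ S
    disjoint : ∀ {S T} → S ∈ 𝓟 → T ∈ 𝓟 → S ≬ T → S ≐ T

{-# OPTIONS --safe #-}

-- Idempotence gives x ∧ - x ≈ x · - x.  Hence y ∈ B x holds exactly when
-- 0[ x ] ≈ 0[ y ], so the blocks are the classes of the kernel of x ↦ 0[ x ].
module Submission where

open import Level using (Level)
open import Algebra.Bundles using (CommutativeSemigroup)
open import Algebra.Lattice.Bundles using (Lattice)
open import Algebra.Structures using (IsIdempotentCommutativeMonoid)
open import Data.Product using (_,_)
open import Function.Base using (id)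
open import Function.Bundles using (Equivalence)
open import Relation.Binary.Bundles using (Poset)
open import Relation.Unary using (_∈_; _⊆_)
import Algebra.Lattice.Properties.Lattice as LatticeProperties
import Algebra.Properties.CommutativeSemigroup as CommutativeSemigroupProperties
import Relation.Binary.Lattice.Bundles as Order
import Relation.Binary.Reasoning.PartialOrder as PartialOrderReasoning
import Relation.Binary.Reasoning.Setoid as SetoidReasoning
open import Defs

-- Membership in a block is controlled by `0[_]`: `y ∈ B x` exactly when `0[ x ] ≈ 0[ y ]`, so
-- blocks are the classes of an equivalence relation. Since negation is an involution, `x ≤ y`
-- amounts to `- y · x ≤ 0#`, which turns order questions into computations with products. By
-- idempotence `0[ x ]` is the product `x · - x`; it is therefore fixed under multiplication by `x`
-- and by `- x`, and its product with `1[ x ]` stays below `0#`. Both directions of the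
-- characterisation (`0[]≈⇒∈B` and `∈B⇒0[]≈`) follow from these facts and `1# ≤ 1[ x ]`.

module _ {c ℓ : Level} (A : CIdInRL c ℓ) where
  open CIdInRL A
  open IsIdempotentCommutativeMonoid ·-isIdempotentCommutativeMonoid
    using (isCommutativeSemigroup; refl; sym; trans; assoc; comm; idem; identityʳ)
    renaming (∙-cong to ·-cong; ∙-congˡ to ·-congˡ; ∙-congʳ to ·-congʳ)

  private
    lattice : Lattice c ℓ
    lattice = record { isLattice = isLattice }

    ·-commutativeSemigroup : CommutativeSemigroup c ℓ
    ·-commutativeSemigroup = record { isCommutativeSemigroup = isCommutativeSemigroup }

    module O = Order.Lattice (LatticeProperties.∨-∧-orderTheoreticLattice lattice)

  open CommutativeSemigroupProperties ·-commutativeSemigroup using (x∙yz≈y∙xz)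

  -- The order in `O` is the equation `x ≈ x ∧ y`, the mirror image of `_≤_`; each transfer between
  -- the two is a `sym`.
  ≤-poset : Poset c ℓ ℓ
  ≤-poset = record
    { _≤_ = _≤_
    ; isPartialOrder = record
      { isPreorder = record
        { isEquivalence = O.isEquivalence
        ; reflexive     = λ x≈y → sym (O.reflexive x≈y)
        ; trans         = λ x≤y y≤z → sym (O.trans (sym x≤y) (sym y≤z))
        }
      ; antisym = λ x≤y y≤x → O.antisym (sym x≤y) (sym y≤x)
      }
    }

  open Poset ≤-poset using ()
    renaming (refl to ≤-refl; reflexive to ≤-reflexive; trans to ≤-trans; antisym to ≤-antisym)

  x∧y≤x : ∀ x y → x ∧ y ≤ x
  x∧y≤x x y = sym (O.x∧y≤x x y)

  x∧y≤y : ∀ x y → x ∧ y ≤ y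
  x∧y≤y x y = sym (O.x∧y≤y x y)

  ∧-greatest : ∀ {x y z} → z ≤ x → z ≤ y → z ≤ x ∧ y
  ∧-greatest z≤x z≤y = sym (O.∧-greatest (sym z≤x) (sym z≤y))

  x≤x∨y : ∀ x y → x ≤ x ∨ y
  x≤x∨y x y = sym (O.x≤x∨y x y)

  y≤x∨y : ∀ x y → y ≤ x ∨ y
  y≤x∨y x y = sym (O.y≤x∨y x y)

  ∨-least : ∀ {x y z} → x ≤ z → y ≤ z → x ∨ y ≤ z
  ∨-least x≤z y≤z = sym (O.∨-least (sym x≤z) (sym y≤z))

  residuate : ∀ {x y z} → x · y ≤ z → y ≤ x ⇒ z
  residuate = Equivalence.to (residuated _ _ _)

  unresiduate : ∀ {x y z} → y ≤ x ⇒ z → x · y ≤ z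
  unresiduate = Equivalence.from (residuated _ _ _)

  -- By residuation `z ≤ x ⇒ x · z`, and `y` lies below `z`.
  ·-monoʳ-≤ : ∀ x {y z} → y ≤ z → x · y ≤ x · z
  ·-monoʳ-≤ x y≤z = unresiduate (≤-trans y≤z (residuate ≤-refl))

  ·-monoˡ-≤ : ∀ x {y z} → y ≤ z → y · x ≤ z · x
  ·-monoˡ-≤ x {y} {z} y≤z = begin
    y · x ≈⟨ comm y x ⟩
    x · y ≤⟨ ·-monoʳ-≤ x y≤z ⟩
    x · z ≈⟨ comm x z ⟩
    z · x ∎
    where open PartialOrderReasoning ≤-poset

  ≤⇒-·≤0 : ∀ {x y} → x ≤ y → - y · x ≤ 0#
  ≤⇒-·≤0 x≤y = unresiduate (≤-trans x≤y (≤-reflexive (sym (involutive _))))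

  -·≤0⇒≤ : ∀ {x y} → - y · x ≤ 0# → x ≤ y
  -·≤0⇒≤ -yx≤0 = ≤-trans (residuate -yx≤0) (≤-reflexive (involutive _))

  neg-swap-≤ : ∀ {x y} → - x ≤ y → - y ≤ x
  neg-swap-≤ {x} {y} -x≤y = -·≤0⇒≤ (≤-trans (≤-reflexive (comm (- x) (- y))) (≤⇒-·≤0 -x≤y))

  x·-x≤0 : ∀ x → x · - x ≤ 0#
  x·-x≤0 x = unresiduate ≤-refl

  -- Squaring the meet bounds it by the product. Conversely, multiplying the product by `x` or by
  -- `- x` leaves it unchanged, hence below `0#`, so it lies below both `- x` and `x`.
  0[x]≈x·-x : ∀ x → 0[ x ] ≈ x · - x
  0[x]≈x·-x x = ≤-antisym 0[x]≤x·-x (∧-greatest (-·≤0⇒≤ -x·x·-x≤0) (residuate x·x·-x≤0))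
    where
    open PartialOrderReasoning ≤-poset
    0[x]≤x·-x : 0[ x ] ≤ x · - x
    0[x]≤x·-x = begin
      0[ x ]          ≈⟨ idem 0[ x ] ⟨
      0[ x ] · 0[ x ] ≤⟨ ·-monoˡ-≤ 0[ x ] (x∧y≤x x (- x)) ⟩
      x · 0[ x ]      ≤⟨ ·-monoʳ-≤ x (x∧y≤y x (- x)) ⟩
      x · - x         ∎
    -x·x·-x≤0 : - x · (x · - x) ≤ 0#
    -x·x·-x≤0 = begin
      - x · (x · - x) ≈⟨ x∙yz≈y∙xz (- x) x (- x) ⟩
      x · (- x · - x) ≈⟨ ·-congˡ (idem (- x)) ⟩
      x · - x         ≤⟨ x·-x≤0 x ⟩
      0#              ∎
    x·x·-x≤0 : x · (x · - x) ≤ 0#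
    x·x·-x≤0 = begin
      x · (x · - x) ≈⟨ assoc x x (- x) ⟨
      (x · x) · - x ≈⟨ ·-congʳ (idem x) ⟩
      x · - x       ≤⟨ x·-x≤0 x ⟩
      0#            ∎

  0[x]≤0 : ∀ x → 0[ x ] ≤ 0#
  0[x]≤0 x = ≤-trans (≤-reflexive (0[x]≈x·-x x)) (x·-x≤0 x)

  x·0[x]≈0[x] : ∀ x → x · 0[ x ] ≈ 0[ x ]
  x·0[x]≈0[x] x = begin
    x · 0[ x ]    ≈⟨ ·-congˡ (0[x]≈x·-x x) ⟩
    x · (x · - x) ≈⟨ assoc x x (- x) ⟨
    (x · x) · - x ≈⟨ ·-congʳ (idem x) ⟩
    x · - x       ≈⟨ 0[x]≈x·-x x ⟨
    0[ x ]        ∎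
    where open SetoidReasoning setoid

  -x·0[x]≈0[x] : ∀ x → - x · 0[ x ] ≈ 0[ x ]
  -x·0[x]≈0[x] x = begin
    - x · 0[ x ]    ≈⟨ ·-congˡ (0[x]≈x·-x x) ⟩
    - x · (x · - x) ≈⟨ x∙yz≈y∙xz (- x) x (- x) ⟩
    x · (- x · - x) ≈⟨ ·-congˡ (idem (- x)) ⟩
    x · - x         ≈⟨ 0[x]≈x·-x x ⟨
    0[ x ]          ∎
    where open SetoidReasoning setoid

  -- Both joinands of `1[ x ]` fix `0[ x ]`, so each lies below `- 0[ x ]`, and so does their join.
  0[x]·1[x]≤0 : ∀ x → 0[ x ] · 1[ x ] ≤ 0#
  0[x]·1[x]≤0 x = unresiduate (∨-least (below (x·0[x]≈0[x] x)) (below (-x·0[x]≈0[x] x)))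
    where
    below : ∀ {z} → z · 0[ x ] ≈ 0[ x ] → z ≤ - 0[ x ]
    below {z} z·0[x]≈0[x] = residuate
      (≤-trans (≤-reflexive (trans (comm 0[ x ] z) z·0[x]≈0[x])) (0[x]≤0 x))

  -- One half of De Morgan suffices: the negation of `1[ x ]` is below `0[ x ]`, hence below `0#`.
  1≤1[x] : ∀ x → 1# ≤ 1[ x ]
  1≤1[x] x = -·≤0⇒≤ (begin
    - 1[ x ] · 1# ≈⟨ identityʳ (- 1[ x ]) ⟩
    - 1[ x ]      ≤⟨ ∧-greatest (neg-swap-≤ (y≤x∨y x (- x)))
                       (neg-swap-≤ (≤-trans (≤-reflexive (involutive x)) (x≤x∨y x (- x)))) ⟩
    0[ x ]        ≤⟨ 0[x]≤0 x ⟩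
    0#            ∎)
    where open PartialOrderReasoning ≤-poset

  0[]≈⇒∈B : ∀ {x y} → 0[ x ] ≈ 0[ y ] → y ∈ B x
  0[]≈⇒∈B {x} {y} 0x≈0y = 0x⊑y , ≤-antisym (-·≤0⇒≤ -y·y·1x≤0) y≤y·1x
    where
    0x⊑y : 0[ x ] ⊑ y
    0x⊑y = begin
      0[ x ] · y ≈⟨ ·-congʳ 0x≈0y ⟩
      0[ y ] · y ≈⟨ comm 0[ y ] y ⟩
      y · 0[ y ] ≈⟨ x·0[x]≈0[x] y ⟩
      0[ y ]     ≈⟨ 0x≈0y ⟨
      0[ x ]     ∎
      where open SetoidReasoning setoid
    open PartialOrderReasoning ≤-poset
    -- This is `y · 1[ x ] ≤ y` in product form; the hypothesis trades `y · - y` for `0[ x ]`.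
    -y·y·1x≤0 : - y · (y · 1[ x ]) ≤ 0#
    -y·y·1x≤0 = begin
      - y · (y · 1[ x ]) ≈⟨ assoc (- y) y 1[ x ] ⟨
      (- y · y) · 1[ x ] ≈⟨ ·-congʳ (comm (- y) y) ⟩
      (y · - y) · 1[ x ] ≈⟨ ·-congʳ (0[x]≈x·-x y) ⟨
      0[ y ] · 1[ x ]    ≈⟨ ·-congʳ 0x≈0y ⟨
      0[ x ] · 1[ x ]    ≤⟨ 0[x]·1[x]≤0 x ⟩
      0#                 ∎
    y≤y·1x : y ≤ y · 1[ x ]
    y≤y·1x = begin
      y          ≈⟨ identityʳ y ⟨
      y · 1#     ≤⟨ ·-monoʳ-≤ y (1≤1[x] x) ⟩
      y · 1[ x ] ∎

  ∈B⇒0[]≈ : ∀ {x y} → y ∈ B x → 0[ x ] ≈ 0[ y ]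
  ∈B⇒0[]≈ {x} {y} (0x⊑y , y⊑1x) = ≤-antisym 0x≤0y 0y≤0x
    where
    open PartialOrderReasoning ≤-poset
    -- Needed for `z` equal to `x` and to `- x`: enlarging `z` to `1[ x ]` lets `y` absorb it.
    z·0y≤0 : ∀ {z} → z ≤ 1[ x ] → z · 0[ y ] ≤ 0#
    z·0y≤0 {z} z≤1x = begin
      z · 0[ y ]         ≈⟨ ·-congˡ (0[x]≈x·-x y) ⟩
      z · (y · - y)      ≤⟨ ·-monoˡ-≤ (y · - y) z≤1x ⟩
      1[ x ] · (y · - y) ≈⟨ assoc 1[ x ] y (- y) ⟨
      (1[ x ] · y) · - y ≈⟨ ·-congʳ (trans (comm 1[ x ] y) y⊑1x) ⟩
      y · - y            ≤⟨ x·-x≤0 y ⟩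
      0#                 ∎
    0y≤0x : 0[ y ] ≤ 0[ x ]
    0y≤0x = ∧-greatest (-·≤0⇒≤ (z·0y≤0 (y≤x∨y x (- x)))) (residuate (z·0y≤0 (x≤x∨y x (- x))))
    y·0x≈0x : y · 0[ x ] ≈ 0[ x ]
    y·0x≈0x = trans (comm y 0[ x ]) 0x⊑y
    -y·0x≤0 : - y · 0[ x ] ≤ 0#
    -y·0x≤0 = begin
      - y · 0[ x ]       ≈⟨ ·-congˡ y·0x≈0x ⟨
      - y · (y · 0[ x ]) ≈⟨ x∙yz≈y∙xz (- y) y 0[ x ] ⟩
      y · (- y · 0[ x ]) ≈⟨ assoc y (- y) 0[ x ] ⟨
      (y · - y) · 0[ x ] ≈⟨ ·-congʳ (0[x]≈x·-x y) ⟨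
      -- The opposite inequality, already established, is what makes this bound work.
      0[ y ] · 0[ x ]    ≤⟨ ·-monoˡ-≤ 0[ x ] 0y≤0x ⟩
      0[ x ] · 0[ x ]    ≈⟨ idem 0[ x ] ⟩
      0[ x ]             ≤⟨ 0[x]≤0 x ⟩
      0#                 ∎
    0x≤0y : 0[ x ] ≤ 0[ y ]
    0x≤0y = ∧-greatest (-·≤0⇒≤ -y·0x≤0)
                       (residuate (≤-trans (≤-reflexive y·0x≈0x) (0[x]≤0 x)))

  B-respects : ∀ {x y z} → y ≈ z → y ∈ B x → z ∈ B x
  B-respects y≈z (0x⊑y , y⊑1x) =
    trans (·-congˡ (sym y≈z)) 0x⊑y , trans (·-congʳ (sym y≈z)) (trans y⊑1x y≈z)

  B-⊆ : ∀ {x y} → 0[ x ] ≈ 0[ y ] → B x ⊆ B y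
  B-⊆ 0x≈0y z∈Bx = 0[]≈⇒∈B (trans (sym 0x≈0y) (∈B⇒0[]≈ z∈Bx))

  B-isPartition : IsPartition setoid Blocks
  B-isPartition = record
    { respects = λ { (_ , S⊆B , B⊆S) y≈z y∈S → B⊆S (B-respects y≈z (S⊆B y∈S)) }
    ; nonempty = λ { (x , _ , B⊆S) → x , B⊆S (0[]≈⇒∈B refl) }
    ; covers   = λ x → B x , (x , id , id) , 0[]≈⇒∈B refl
    ; disjoint = λ { (x , S⊆Bx , Bx⊆S) (y , T⊆By , By⊆T) (z , z∈S , z∈T) →
        -- The common point `z` links the two blocks through `0[ z ]`.
        let 0x≈0y = trans (∈B⇒0[]≈ (S⊆Bx z∈S)) (sym (∈B⇒0[]≈ (T⊆By z∈T)))
        in (λ w∈S → By⊆T (B-⊆ 0x≈0y (S⊆Bx w∈S)))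
         , (λ w∈T → Bx⊆S (B-⊆ (sym 0x≈0y) (T⊆By w∈T))) }
    }

proposition3p4 : ∀ {c ℓ : Level} (A : CIdInRL c ℓ) → IsPartition (CIdInRL.setoid A) (CIdInRL.Blocks A)
proposition3p4 = B-isPartition
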